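{- Let $n\geq 1$ and $m\geq 1$ with $(n,m)\notin\{(1,1),(1,2),(2,1),(2,2),(3,3),(3,4),(4,3)\}$. If there exists an $n\times m$ min-$2$TDS matrix with no all-$0$ rows and no all-$0$ columns, then there exists an $n\times m$ min-$2$TDS matrix $M$ all of whose components, up to permutations of rows and columns, are $J(1,3)$ or $J(3,1)$, except possibly for (i) exactly one $J(x,1)$ component with $4\leq x\leq 7$; or (ii) exactly one $J(1,y)$ component with $4\leq y\leq 7$; or (iii) exactly one $J(x,1)$ component with $4\leq x\leq 5$ and exactly one $J(1,y)$ component with $4\leq y\leq 5$. Further, the number of ones in $M$ is $\lceil 3(n+m)/4\rceil+1$ if $m\equiv 3n+4 \pmod 8$, and $\lceil 3(n+m)/4\rceil$ otherwise.
   Context: For an $n\times m$ $(0,1)$-matrix $M=(m_{ij})$, define $\kappa(i,j)$ as the $i$-th row sum plus the $j$-th column sum minus $2m_{ij}$; $M$ is a $k$TDS matrix if $\kappa(i,j)\geq k$ for all cells. A min-$k$TDS matrix is an $n\times m$ $k$TDS matrix whose number of ones is the minimum possible among all $n\times m$ $k$TDS matrices (this minimum equals $\gamma_{\times k,t}(K_n\Box K_m)$). Given $M$, let $\Gamma(M)$ be the graph whose vertices are the positions of the ones of $M$, two ones adjacent iff they lie in the same row or column with no other one strictly between them. The components of $M$ are the connected components of $\Gamma(M)$, each identified with the submatrix of $M$ on the rows and columns its ones meet. $J(x,y)$ denotes the $x\times y$ all-ones matrix. -}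

module Defs where

open import Data.Nat using (ℕ; zero; suc; _+_; _*_; _∸_; _≤_; _≥_; _/_; _%_)
open import Data.Bool using (Bool; true; false; if_then_else_)
open import Data.Fin using (Fin; toℕ) renaming (zero to fzero; suc to fsuc)
import Data.Fin as F
open import Data.Product using (_×_; _,_; Σ; ∃; ∃-syntax)
open import Data.Sum using (_⊎_)
open import Relation.Binary.PropositionalEquality using (_≡_; _≢_)
open import Relation.Binary.Construct.Closure.ReflexiveTransitive using (Star)
open import Function.Definitions using (Injective)
open import Relation.Nullary using (yes; no)
open import Data.Empty renaming (⊥ to ⊥')

Matrix : ℕ → ℕ → Set
Matrix n m = Fin n → Fin m → Bool

val : Bool → ℕ
val true  = 1
val false = 0

sumFin : ∀ {k} → (Fin k → ℕ) → ℕ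
sumFin {zero}  f = 0
sumFin {suc k} f = f fzero + sumFin (λ i → f (fsuc i))

rowSum : ∀ {n m} → Matrix n m → Fin n → ℕ
rowSum M i = sumFin (λ j → val (M i j))

colSum : ∀ {n m} → Matrix n m → Fin m → ℕ
colSum M j = sumFin (λ i → val (M i j))

ones : ∀ {n m} → Matrix n m → ℕ
ones M = sumFin (λ i → rowSum M i)

-- κ(i,j) = row sum + column sum − 2 m_ij  (never truncated, since m_ij is
-- counted in both sums)
κ : ∀ {n m} → Matrix n m → Fin n → Fin m → ℕ
κ M i j = (rowSum M i + colSum M j) ∸ (2 * val (M i j))

IsKTDS : ∀ {n m} → ℕ → Matrix n m → Set
IsKTDS k M = ∀ i j → κ M i j ≥ k

IsMinKTDS : ∀ {n m} → ℕ → Matrix n m → Set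
IsMinKTDS {n} {m} k M = IsKTDS k M × (∀ (M' : Matrix n m) → IsKTDS k M' → ones M ≤ ones M')

NoZeroRow : ∀ {n m} → Matrix n m → Set
NoZeroRow {n} {m} M = ∀ (i : Fin n) → ∃[ j ] M i j ≡ true

NoZeroCol : ∀ {n m} → Matrix n m → Set
NoZeroCol {n} {m} M = ∀ (j : Fin m) → ∃[ i ] M i j ≡ true

Cell : ℕ → ℕ → Set
Cell n m = Fin n × Fin m

IsOne : ∀ {n m} → Matrix n m → Cell n m → Set
IsOne M (i , j) = M i j ≡ true

StrictlyBetween : ∀ {k} → Fin k → Fin k → Fin k → Set
StrictlyBetween a l b = (a F.< l × l F.< b) ⊎ (b F.< l × l F.< a)

Adj : ∀ {n m} → Matrix n m → Cell n m → Cell n m → Set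
Adj M (i , j) (i' , j') =
  M i j ≡ true × M i' j' ≡ true ×
  ( (i ≡ i' × j ≢ j' × (∀ l → StrictlyBetween j l j' → M i l ≡ false))
  ⊎ (j ≡ j' × i ≢ i' × (∀ l → StrictlyBetween i l i' → M l j ≡ false)))

Conn : ∀ {n m} → Matrix n m → Cell n m → Cell n m → Set
Conn M = Star (Adj M)

-- The component of M containing the one at cell p is, up to permutations of
-- rows and columns, J(x,y): there are x distinct rows R and y distinct
-- columns C such that the ones of the component are exactly the cells of
-- R × C (hence the submatrix on the rows and columns met by the component
-- is the all-ones x × y matrix).
CompIsJ : ∀ {n m} → Matrix n m → Cell n m → ℕ → ℕ → Set
CompIsJ {n} {m} M p x y =
  Σ (Fin x → Fin n) λ R → Σ (Fin y → Fin m) λ C →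
    Injective _≡_ _≡_ R × Injective _≡_ _≡_ C ×
    (∀ i j → (M i j ≡ true × Conn M p (i , j)) → (∃[ a ] R a ≡ i × ∃[ b ] C b ≡ j)) ×
    (∀ a b → M (R a) (C b) ≡ true × Conn M p (R a , C b))

Basic : ∀ {n m} → Matrix n m → Cell n m → Set
Basic M p = CompIsJ M p 1 3 ⊎ CompIsJ M p 3 1

GoodComponents : ∀ {n m} → Matrix n m → Set
GoodComponents {n} {m} M =
  (∀ p → IsOne M p → Basic M p)
  ⊎ (∃[ x ] 4 ≤ x × x ≤ 7 × ∃[ p₀ ] IsOne M p₀ × CompIsJ M p₀ x 1 ×
       (∀ p → IsOne M p → (Conn M p₀ p → ⊥') → Basic M p))
  ⊎ (∃[ y ] 4 ≤ y × y ≤ 7 × ∃[ p₀ ] IsOne M p₀ × CompIsJ M p₀ 1 y ×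
       (∀ p → IsOne M p → (Conn M p₀ p → ⊥') → Basic M p))
  ⊎ (∃[ x ] ∃[ y ] 4 ≤ x × x ≤ 5 × 4 ≤ y × y ≤ 5 ×
       ∃[ p₀ ] ∃[ p₁ ] IsOne M p₀ × IsOne M p₁ × CompIsJ M p₀ x 1 × CompIsJ M p₁ 1 y ×
       (∀ p → IsOne M p → (Conn M p₀ p → ⊥') → (Conn M p₁ p → ⊥') → Basic M p))

ceil3Quarter : ℕ → ℕ
ceil3Quarter s = (3 * s + 3) / 4

expectedOnes : ℕ → ℕ → ℕ
expectedOnes n m with m % 8 Data.Nat.≟ (3 * n + 4) % 8
... | yes _ = ceil3Quarter (n + m) + 1
... | no _ = ceil3Quarter (n + m)

Excluded : ℕ → ℕ → Set
Excluded n m =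
  (n ≡ 1 × m ≡ 1) ⊎ (n ≡ 1 × m ≡ 2) ⊎ (n ≡ 2 × m ≡ 1) ⊎ (n ≡ 2 × m ≡ 2) ⊎
  (n ≡ 3 × m ≡ 3) ⊎ (n ≡ 3 × m ≡ 4) ⊎ (n ≡ 4 × m ≡ 3)

{-# OPTIONS --safe #-}

-- Read M as a bipartite graph on n + m vertices.  Without zero rows and columns,
-- 2TDS says that deg u + deg v ≥ 4 along every edge.  Give each vertex of degree d
-- the charge 2d − 3 and let each vertex of degree ≥ 3 send 1 along every edge.  Every
-- leaf hangs on such a vertex, so no charge stays negative and 3(n + m) ≤ 4E; equality
-- forces every degree to be 1 or 3, hence m ≡ 3n (mod 8).  Block-diagonal matrices
-- attain the resulting bound as long as n and m are not too far apart, which minimality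
-- ensures: comparison with the matrix whose first two columns are full gives E ≤ 2n,
-- so 3m ≤ 5n, and likewise 3n ≤ 5m.

module Submission where

open import Defs
import Algebra.Properties.Semiring.Sum
open import Data.Bool using (Bool; true; false)
import Data.Bool.Properties as Bool
open import Data.Fin using (Fin; zero; suc; toℕ; _↑ˡ_; _↑ʳ_; splitAt)
import Data.Fin as Fin
open import Data.Fin.Patterns using (0F; 1F)
import Data.Fin.Properties as Fin
open import Data.List using (List; []; _∷_; _++_; lookup)
open import Data.List.Membership.Propositional.Properties using (∈-lookup)
open import Data.List.Relation.Unary.All as All using (All; []; _∷_)
open import Data.List.Relation.Unary.All.Properties using (++⁺)
open import Data.Nat
open import Data.Nat.Divisibility using (_∣_; divides; divides-refl; _∣?_; ∣m+n∣m⇒∣n)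
open import Data.Nat.DivMod using (_/_; _%_; %-distribˡ-+; [m+kn]%n≡m%n; m≡m%n+[m/n]*n; /-monoˡ-≤; +-distrib-/-∣ʳ; m*n/n≡m)
open import Data.Nat.Properties
open import Data.Nat.Tactic.RingSolver using (solve-∀)
open import Data.Product using (_×_; _,_; ∃-syntax; proj₁; proj₂)
open import Data.Sum using (_⊎_; inj₁; inj₂; [_,_]′)
open import Function using (_∘_; flip; const)
open import Function.Definitions using (Injective)
open import Relation.Nullary using (¬_; contradiction; yes; no; does)
open import Relation.Nullary.Decidable using (_×-dec_; dec-true; dec-false; from-no)
open import Relation.Binary.Construct.Closure.ReflexiveTransitive using (Star; ε; _◅_; _◅◅_; gmap; reverse)
open import Relation.Binary.PropositionalEquality

-- Finite sums

private
  module Σℕ = Algebra.Properties.Semiring.Sum +-*-semiring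

sumFin≡sum : ∀ {k} (f : Fin k → ℕ) → sumFin f ≡ Σℕ.sum f
sumFin≡sum {zero}  f = refl
sumFin≡sum {suc k} f = cong (f zero +_) (sumFin≡sum (f ∘ suc))

sumFin-cong : ∀ {k} {f g : Fin k → ℕ} → (∀ i → f i ≡ g i) → sumFin f ≡ sumFin g
sumFin-cong {zero}  f≗g = refl
sumFin-cong {suc k} f≗g = cong₂ _+_ (f≗g zero) (sumFin-cong (f≗g ∘ suc))

sumFin-mono-≤ : ∀ {k} {f g : Fin k → ℕ} → (∀ i → f i ≤ g i) → sumFin f ≤ sumFin g
sumFin-mono-≤ {zero}  f≤g = z≤n
sumFin-mono-≤ {suc k} f≤g = +-mono-≤ (f≤g zero) (sumFin-mono-≤ (f≤g ∘ suc))

-- A strict inequality at one index could not be made up for at the others. This is what extracts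
-- the equality case of the discharging argument.
sumFin-≤-≡ : ∀ {k} {f g : Fin k → ℕ} → (∀ i → f i ≤ g i) → sumFin g ≤ sumFin f → ∀ i → f i ≡ g i
sumFin-≤-≡ {suc k} {f} {g} f≤g Σg≤Σf zero = ≤-antisym (f≤g zero)
  (+-cancelʳ-≤ (sumFin (g ∘ suc)) _ _
    (≤-trans Σg≤Σf (+-monoʳ-≤ (f zero) (sumFin-mono-≤ (f≤g ∘ suc)))))
sumFin-≤-≡ {suc k} {f} {g} f≤g Σg≤Σf (suc i) = sumFin-≤-≡ (f≤g ∘ suc)
  (+-cancelˡ-≤ (g zero) _ _
    (≤-trans Σg≤Σf (+-monoˡ-≤ (sumFin (f ∘ suc)) (f≤g zero)))) i

term≤sumFin : ∀ {k} (f : Fin k → ℕ) i → f i ≤ sumFin f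
term≤sumFin f zero    = m≤m+n _ _
term≤sumFin f (suc i) = ≤-trans (term≤sumFin (f ∘ suc) i) (m≤n+m _ _)

sumFin-const : ∀ k c → sumFin {k} (λ _ → c) ≡ k * c
sumFin-const zero    c = refl
sumFin-const (suc k) c = cong (c +_) (sumFin-const k c)

sumFin-+ : ∀ {k} (f g : Fin k → ℕ) → sumFin (λ i → f i + g i) ≡ sumFin f + sumFin g
sumFin-+ f g
  rewrite sumFin≡sum (λ i → f i + g i) | sumFin≡sum f | sumFin≡sum g = Σℕ.∑-distrib-+ f g

sumFin-*ˡ : ∀ {k} c (f : Fin k → ℕ) → sumFin (λ i → c * f i) ≡ c * sumFin f
sumFin-*ˡ c f rewrite sumFin≡sum (λ i → c * f i) | sumFin≡sum f = sym (Σℕ.*-distribˡ-sum c f)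

sumFin-*ʳ : ∀ {k} c (f : Fin k → ℕ) → sumFin (λ i → f i * c) ≡ sumFin f * c
sumFin-*ʳ c f rewrite sumFin≡sum (λ i → f i * c) | sumFin≡sum f = sym (Σℕ.*-distribʳ-sum c f)

sumFin-comm : ∀ {k l} (f : Fin k → Fin l → ℕ) →
  sumFin (λ i → sumFin (f i)) ≡ sumFin (λ j → sumFin (λ i → f i j))
sumFin-comm f = begin
  sumFin (λ i → sumFin (f i))              ≡⟨ sumFin²≡sum² f ⟩
  Σℕ.sum (λ i → Σℕ.sum (f i))              ≡⟨ Σℕ.∑-comm f ⟩
  Σℕ.sum (λ j → Σℕ.sum (λ i → f i j))      ≡⟨ sumFin²≡sum² (flip f) ⟨
  sumFin (λ j → sumFin (λ i → f i j))      ∎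
  where
  open ≡-Reasoning
  sumFin²≡sum² : ∀ {k l} (f : Fin k → Fin l → ℕ) →
    sumFin (λ i → sumFin (f i)) ≡ Σℕ.sum (λ i → Σℕ.sum (f i))
  sumFin²≡sum² f = trans (sumFin-cong (sumFin≡sum ∘ f)) (sumFin≡sum (λ i → Σℕ.sum (f i)))

-- Transposition and degree conditions

infix 8 _ᵀ
_ᵀ : ∀ {n m} → Matrix n m → Matrix m n
(M ᵀ) j i = M i j

ones-ᵀ : ∀ {n m} (M : Matrix n m) → ones (M ᵀ) ≡ ones M
ones-ᵀ M = sym (sumFin-comm (λ i j → val (M i j)))

IsKTDS-ᵀ : ∀ {n m k} (M : Matrix n m) → IsKTDS k M → IsKTDS k (M ᵀ)
IsKTDS-ᵀ {k = k} M tds j i =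
  subst (λ s → k ≤ s ∸ 2 * val (M i j)) (+-comm (rowSum M i) (colSum M j)) (tds i j)

IsMinKTDS-ᵀ : ∀ {n m k} (M : Matrix n m) → IsMinKTDS k M → IsMinKTDS k (M ᵀ)
IsMinKTDS-ᵀ M (tds , least) = IsKTDS-ᵀ M tds , λ N Ntds →
  subst₂ _≤_ (sym (ones-ᵀ M)) (ones-ᵀ N) (least (N ᵀ) (IsKTDS-ᵀ N Ntds))

one⇒4≤r+c : ∀ {n m} (M : Matrix n m) → IsKTDS 2 M → ∀ {i j} → M i j ≡ true →
  4 ≤ rowSum M i + colSum M j
one⇒4≤r+c M tds {i} {j} Mij with tds i j
... | 2≤κ rewrite Mij = lower _ 2≤κ
  where
  -- The bound 2 rules out `s` ≤ 1, where truncated subtraction would give 0.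
  lower : ∀ s → 2 ≤ s ∸ 2 → 4 ≤ s
  lower (suc (suc s)) 2≤s = s≤s (s≤s 2≤s)

1≤rowSum : ∀ {n m} (M : Matrix n m) → NoZeroRow M → ∀ i → 1 ≤ rowSum M i
1≤rowSum M nzr i with nzr i
... | j , Mij = ≤-trans (≤-reflexive (cong val (sym Mij))) (term≤sumFin (λ j → val (M i j)) j)

-- Discharging

leaf heavy : ℕ → ℕ
leaf 1 = 1
leaf _ = 0
heavy (suc (suc (suc _))) = 1
heavy _ = 0

leaf≤heavy : ∀ r c → 4 ≤ r + c → leaf r ≤ heavy c
leaf≤heavy zero          c _ = z≤n
leaf≤heavy (suc (suc r)) c _ = z≤n
leaf≤heavy 1 (suc (suc (suc c))) _ = ≤-refl
leaf≤heavy 1 0 (s≤s ())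
leaf≤heavy 1 1 (s≤s (s≤s ()))
leaf≤heavy 1 2 (s≤s (s≤s (s≤s ())))

-- Nonnegativity of the final charge, with the subtracted terms moved to the left. A leaf has a
-- single edge, so `d * leaf d` is the 1 it receives; whatever other vertices receive is left out.
-- The slack is 0 for d = 1, 1 for d = 2 and d - 3 for d ≥ 3.
charge-≤ : ∀ d → 1 ≤ d → 3 + d * heavy d ≤ 2 * d + d * leaf d
charge-≤ 1 _ = ≤-refl
charge-≤ 2 _ = n≤1+n 3
charge-≤ (suc (suc (suc k))) _ = subst₂ _≤_ (lhs k) (rhs k) (m≤m+n (6 + k) k)
  where
  lhs : ∀ k → 6 + k ≡ 3 + (3 + k) * 1
  lhs = solve-∀
  rhs : ∀ k → 6 + k + k ≡ 2 * (3 + k) + (3 + k) * 0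
  rhs = solve-∀

-- Zero slack leaves only d = 1 and d = 3, and the formula `1 + 2 * heavy d` covers both in a form
-- that can be summed.
charge-≡ : ∀ d → 1 ≤ d → 3 + d * heavy d ≡ 2 * d + d * leaf d → d ≡ 1 + 2 * heavy d
charge-≡ 1 _ _ = refl
charge-≡ (suc (suc (suc k))) _ eq = cong (3 +_) (+-cancelˡ-≡ (6 + k) k 0 (begin
  6 + k + k                      ≡⟨ rhs k ⟩
  2 * (3 + k) + (3 + k) * 0      ≡⟨ eq ⟨
  3 + (3 + k) * 1                ≡⟨ lhs k ⟩
  6 + k + 0                      ∎))
  where
  open ≡-Reasoning
  lhs : ∀ k → 3 + (3 + k) * 1 ≡ 6 + k + 0
  lhs = solve-∀
  rhs : ∀ k → 6 + k + k ≡ 2 * (3 + k) + (3 + k) * 0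
  rhs = solve-∀

module Degrees {k} (d : Fin k → ℕ) (1≤d : ∀ i → 1 ≤ d i) where

  Σd Σleaf Σheavy : ℕ
  Σd     = sumFin d
  Σleaf  = sumFin (λ i → d i * leaf (d i))
  Σheavy = sumFin (λ i → d i * heavy (d i))

  private
    Σlhs : sumFin (λ i → 3 + d i * heavy (d i)) ≡ k * 3 + Σheavy
    Σlhs = trans (sumFin-+ (λ _ → 3) (λ i → d i * heavy (d i))) (cong (_+ Σheavy) (sumFin-const k 3))

    Σrhs : sumFin (λ i → 2 * d i + d i * leaf (d i)) ≡ 2 * Σd + Σleaf
    Σrhs = trans (sumFin-+ (λ i → 2 * d i) (λ i → d i * leaf (d i))) (cong (_+ Σleaf) (sumFin-*ˡ 2 d))

  Σcharge-≤ : k * 3 + Σheavy ≤ 2 * Σd + Σleaf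
  Σcharge-≤ = subst₂ _≤_ Σlhs Σrhs (sumFin-mono-≤ (λ i → charge-≤ (d i) (1≤d i)))

  -- The reverse inequality makes every vertex tight, so all degrees are 1 or 3; the witness `h`
  -- counts the vertices of degree 3.
  Σcharge-≥⇒ : 2 * Σd + Σleaf ≤ k * 3 + Σheavy → ∃[ h ] Σd ≡ k + 2 * h
  Σcharge-≥⇒ le = sumFin (heavy ∘ d) , (begin
    sumFin d                                           ≡⟨ sumFin-cong (λ i → charge-≡ (d i) (1≤d i) (tight i)) ⟩
    sumFin (λ i → 1 + 2 * heavy (d i))                 ≡⟨ sumFin-+ (λ _ → 1) (λ i → 2 * heavy (d i)) ⟩
    sumFin {k} (λ _ → 1) + sumFin (λ i → 2 * heavy (d i))
      ≡⟨ cong₂ _+_ (trans (sumFin-const k 1) (*-identityʳ k)) (sumFin-*ˡ 2 (heavy ∘ d)) ⟩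
    k + 2 * sumFin (heavy ∘ d)                         ∎)
    where
    open ≡-Reasoning
    tight : ∀ i → 3 + d i * heavy (d i) ≡ 2 * d i + d i * leaf (d i)
    tight = sumFin-≤-≡ (λ i → charge-≤ (d i) (1≤d i)) (subst₂ _≤_ (sym Σrhs) (sym Σlhs) le)

-- A leaf row has its single one in a heavy column, so counting ones from both
-- sides compares the leaf rows with the heavy columns.
Σleaf≤Σheavy : ∀ {n m} (M : Matrix n m) → IsKTDS 2 M →
  sumFin (λ i → rowSum M i * leaf (rowSum M i)) ≤ sumFin (λ j → colSum M j * heavy (colSum M j))
Σleaf≤Σheavy M tds = begin
  sumFin (λ i → rowSum M i * leaf (rowSum M i))
    ≡⟨ sumFin-cong (λ i → sumFin-*ʳ (leaf (rowSum M i)) (λ j → val (M i j))) ⟨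
  sumFin (λ i → sumFin (λ j → val (M i j) * leaf (rowSum M i)))
    ≤⟨ sumFin-mono-≤ (λ i → sumFin-mono-≤ (λ j → entry i j)) ⟩
  sumFin (λ i → sumFin (λ j → val (M i j) * heavy (colSum M j)))
    ≡⟨ sumFin-comm (λ i j → val (M i j) * heavy (colSum M j)) ⟩
  sumFin (λ j → sumFin (λ i → val (M i j) * heavy (colSum M j)))
    ≡⟨ sumFin-cong (λ j → sumFin-*ʳ (heavy (colSum M j)) (λ i → val (M i j))) ⟩
  sumFin (λ j → colSum M j * heavy (colSum M j)) ∎
  where
  open ≤-Reasoning
  entry : ∀ i j → val (M i j) * leaf (rowSum M i) ≤ val (M i j) * heavy (colSum M j)
  entry i j with M i j in eq
  ... | false = z≤n
  ... | true  = +-monoˡ-≤ 0 (leaf≤heavy (rowSum M i) (colSum M j) (one⇒4≤r+c M tds eq))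

module LowerBound {n m} (M : Matrix n m) (tds : IsKTDS 2 M) (nzr : NoZeroRow M) (nzc : NoZeroCol M) where

  private
    module R = Degrees (rowSum M) (1≤rowSum M nzr)
    module C = Degrees (colSum M) (1≤rowSum (M ᵀ) nzc)
    E = ones M

    columnCharge : m * 3 + C.Σheavy ≤ 2 * E + C.Σleaf
    columnCharge = subst (λ e → m * 3 + C.Σheavy ≤ 2 * e + C.Σleaf) (ones-ᵀ M) C.Σcharge-≤

    leafRows : R.Σleaf ≤ C.Σheavy
    leafRows = Σleaf≤Σheavy M tds

    leafCols : C.Σleaf ≤ R.Σheavy
    leafCols = Σleaf≤Σheavy (M ᵀ) (IsKTDS-ᵀ M tds)

  -- When the charge inequalities of rows and columns are added, the transfers cancel: what the
  -- leaves of one side receive is at most what the heavy vertices of the other side send.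
  3[n+m]≤4E : 3 * (n + m) ≤ 4 * E
  3[n+m]≤4E = +-cancelʳ-≤ (R.Σheavy + C.Σheavy) _ _ (begin
    3 * (n + m) + (R.Σheavy + C.Σheavy)             ≡⟨ split n m R.Σheavy C.Σheavy ⟩
    (n * 3 + R.Σheavy) + (m * 3 + C.Σheavy)         ≤⟨ +-mono-≤ R.Σcharge-≤ columnCharge ⟩
    (2 * E + R.Σleaf) + (2 * E + C.Σleaf)           ≤⟨ +-mono-≤ (+-monoʳ-≤ (2 * E) leafRows) (+-monoʳ-≤ (2 * E) leafCols) ⟩
    (2 * E + C.Σheavy) + (2 * E + R.Σheavy)         ≡⟨ join E R.Σheavy C.Σheavy ⟩
    4 * E + (R.Σheavy + C.Σheavy)                   ∎)
    where
    open ≤-Reasoning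
    split : ∀ n m h h′ → 3 * (n + m) + (h + h′) ≡ (n * 3 + h) + (m * 3 + h′)
    split = solve-∀
    join : ∀ e h h′ → (2 * e + h′) + (2 * e + h) ≡ 4 * e + (h + h′)
    join = solve-∀

  -- A tight total forces the column inequality to be tight, so E = m + 2h with h columns of degree
  -- 3. Substituting this into 4E = 3(n + m) leaves m + 8h = 3n.
  tight⇒m≡3n[mod8] : 4 * E ≡ 3 * (n + m) → ∃[ h ] m + 8 * h ≡ 3 * n
  tight⇒m≡3n[mod8] tight with C.Σcharge-≥⇒ (subst (λ e → 2 * e + C.Σleaf ≤ m * 3 + C.Σheavy) (sym (ones-ᵀ M)) slack)
    where
    open ≤-Reasoning
    l₂ : ∀ e l h → (2 * e + l) + (2 * e + h) ≡ 4 * e + (l + h)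
    l₂ = solve-∀
    l₃ : ∀ n m h h′ → 3 * (n + m) + (h + h′) ≡ m * 3 + h′ + (n * 3 + h)
    l₃ = solve-∀
    -- Adding the row inequality to both sides reduces the claim to the tight total.
    slack : 2 * E + C.Σleaf ≤ m * 3 + C.Σheavy
    slack = +-cancelʳ-≤ (n * 3 + R.Σheavy) _ _ (begin
      2 * E + C.Σleaf + (n * 3 + R.Σheavy)      ≤⟨ +-monoʳ-≤ (2 * E + C.Σleaf) R.Σcharge-≤ ⟩
      2 * E + C.Σleaf + (2 * E + R.Σleaf)       ≤⟨ +-mono-≤ (+-monoʳ-≤ (2 * E) leafCols) (+-monoʳ-≤ (2 * E) leafRows) ⟩
      2 * E + R.Σheavy + (2 * E + C.Σheavy)     ≡⟨ l₂ E R.Σheavy C.Σheavy ⟩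
      4 * E + (R.Σheavy + C.Σheavy)             ≡⟨ cong (_+ (R.Σheavy + C.Σheavy)) tight ⟩
      3 * (n + m) + (R.Σheavy + C.Σheavy)       ≡⟨ l₃ n m R.Σheavy C.Σheavy ⟩
      m * 3 + C.Σheavy + (n * 3 + R.Σheavy)     ∎)
  ... | h , ΣC≡ = h , +-cancelˡ-≡ (3 * m) _ _ (begin
      3 * m + (m + 8 * h)       ≡⟨ l₄ m h ⟩
      4 * (m + 2 * h)           ≡⟨ cong (4 *_) (trans (sym ΣC≡) (ones-ᵀ M)) ⟩
      4 * E                     ≡⟨ tight ⟩
      3 * (n + m)               ≡⟨ l₅ n m ⟩
      3 * m + 3 * n             ∎)
    where
    open ≡-Reasoning
    l₄ : ∀ m h → 3 * m + (m + 8 * h) ≡ 4 * (m + 2 * h)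
    l₄ = solve-∀
    l₅ : ∀ n m → 3 * (n + m) ≡ 3 * m + 3 * n
    l₅ = solve-∀

-- Connectivity along rows and columns

Consecutive : ∀ {k} → (Fin k → Bool) → Fin k → Fin k → Set
Consecutive P a b =
  P a ≡ true × P b ≡ true × a ≢ b × (∀ l → StrictlyBetween a l b → P l ≡ false)

module _ {k} (P : Fin k → Bool) where

  private
    consecutive-sym : ∀ {a b} → Consecutive P a b → Consecutive P b a
    consecutive-sym (Pa , Pb , a≢b , gap) = Pb , Pa , a≢b ∘ sym , λ where
      l (inj₁ bt) → gap l (inj₂ bt)
      l (inj₂ bt) → gap l (inj₁ bt)

    -- The recursion runs on `d`, a bound for the distance from `a` to `b`. A one strictly between
    -- them splits the interval into two shorter ones; if there is none, `a` and `b` are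
    -- consecutive.
    upward : ∀ d {a b} → toℕ b ≤ d + toℕ a → a Fin.≤ b → P a ≡ true → P b ≡ true →
      Star (Consecutive P) a b
    upward d {a} {b} b≤d+a a≤b Pa Pb with a Fin.≟ b
    ... | yes refl = ε
    upward zero b≤a a≤b Pa Pb | no a≢b =
      contradiction (Fin.toℕ-injective (≤-antisym a≤b b≤a)) a≢b
    upward (suc d) {a} {b} b≤d+a a≤b Pa Pb | no a≢b
      with Fin.any? (λ l → (a Fin.<? l ×-dec l Fin.<? b) ×-dec P l Bool.≟ true)
    ... | yes (l , (a<l , l<b) , Pl) =
      upward d (s≤s⁻¹ (≤-trans l<b b≤d+a)) (<⇒≤ a<l) Pa Pl ◅◅
      upward d (≤-trans (≤-trans b≤d+a (≤-reflexive (sym (+-suc d (toℕ a))))) (+-monoʳ-≤ d a<l))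
        (<⇒≤ l<b) Pl Pb
    ... | no none = (Pa , Pb , a≢b , gap) ◅ ε
      where
      gap : ∀ l → StrictlyBetween a l b → P l ≡ false
      gap l (inj₁ bt) = Bool.¬-not (λ Pl → none (l , bt , Pl))
      gap l (inj₂ (b<l , l<a)) = contradiction (<-trans b<l l<a) (≤⇒≯ a≤b)

  connected : ∀ {a b} → P a ≡ true → P b ≡ true → Star (Consecutive P) a b
  connected {a} {b} Pa Pb with ≤-total (toℕ a) (toℕ b)
  ... | inj₁ a≤b = upward (toℕ b) (m≤m+n _ _) a≤b Pa Pb
  ... | inj₂ b≤a = reverse consecutive-sym (upward (toℕ a) (m≤m+n _ _) b≤a Pb Pa)

module _ {n m} (M : Matrix n m) where

  -- With row `i` as the predicate, `Consecutive` is the horizontal case of `Adj`.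
  row-connected : ∀ {i j j′} → M i j ≡ true → M i j′ ≡ true → Conn M (i , j) (i , j′)
  row-connected {i} Mij Mij′ = gmap (i ,_)
    (λ (p , q , j≢j′ , gap) → p , q , inj₁ (refl , j≢j′ , gap)) (connected (M i) Mij Mij′)

  col-connected : ∀ {i i′ j} → M i j ≡ true → M i′ j ≡ true → Conn M (i , j) (i′ , j)
  col-connected {j = j} Mij Mi′j = gmap (_, j)
    (λ (p , q , i≢i′ , gap) → p , q , inj₂ (refl , i≢i′ , gap)) (connected (λ i → M i j) Mij Mi′j)

-- Block-diagonal matrices

-- `Fin (sumFin s)` is cut into consecutive intervals of lengths `s l`. `label` names the interval
-- of an index, and `member s l` enumerates the interval `l`.
label : ∀ {k} (s : Fin k → ℕ) → Fin (sumFin s) → Fin k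
label {suc k} s i = [ const zero , suc ∘ label (s ∘ suc) ]′ (splitAt (s zero) i)

member : ∀ {k} (s : Fin k → ℕ) l → Fin (s l) → Fin (sumFin s)
member s zero    a = a ↑ˡ _
member s (suc l) a = s zero ↑ʳ member (s ∘ suc) l a

label-member : ∀ {k} (s : Fin k → ℕ) l a → label s (member s l a) ≡ l
label-member s zero a rewrite Fin.splitAt-↑ˡ (s zero) a (sumFin (s ∘ suc)) = refl
label-member s (suc l) a
  rewrite Fin.splitAt-↑ʳ (s zero) (sumFin (s ∘ suc)) (member (s ∘ suc) l a) =
  cong suc (label-member (s ∘ suc) l a)

member-injective : ∀ {k} (s : Fin k → ℕ) l → Injective _≡_ _≡_ (member s l)
member-injective s zero    eq = Fin.↑ˡ-injective _ _ _ eq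
member-injective s (suc l) eq = member-injective (s ∘ suc) l (Fin.↑ʳ-injective (s zero) _ _ eq)

member-label : ∀ {k} (s : Fin k → ℕ) i → ∃[ a ] member s (label s i) a ≡ i
member-label {suc k} s i with splitAt (s zero) i in eq
... | inj₁ a = a , Fin.splitAt⁻¹-↑ˡ eq
... | inj₂ i′ with member-label (s ∘ suc) i′
...   | a , member≡ = a , trans (cong (s zero ↑ʳ_) member≡) (Fin.splitAt⁻¹-↑ʳ eq)

sumFin-++ : ∀ a {b} (f : Fin (a + b) → ℕ) →
  sumFin f ≡ sumFin (λ i → f (i ↑ˡ b)) + sumFin (λ i → f (a ↑ʳ i))
sumFin-++ zero    f = refl
sumFin-++ (suc a) f = trans (cong (f zero +_) (sumFin-++ a (f ∘ suc))) (sym (+-assoc (f zero) _ _))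

sumFin-member : ∀ {k} (s : Fin k → ℕ) (f : Fin (sumFin s) → ℕ) →
  sumFin f ≡ sumFin (λ l → sumFin (λ a → f (member s l a)))
sumFin-member {zero}  s f = refl
sumFin-member {suc k} s f = trans (sumFin-++ (s zero) f)
  (cong (sumFin (λ i → f (i ↑ˡ sumFin (s ∘ suc))) +_) (sumFin-member (s ∘ suc) (λ i → f (s zero ↑ʳ i))))

-- The summand is constant on each interval, so interval `l` contributes `g l` once for each of its
-- `s l` indices.
sumFin-label : ∀ {k} (s : Fin k → ℕ) (g : Fin k → ℕ) →
  sumFin (λ i → g (label s i)) ≡ sumFin (λ l → s l * g l)
sumFin-label s g = trans (sumFin-member s (λ i → g (label s i))) (sumFin-cong λ l →
  trans (sumFin-cong (λ a → cong g (label-member s l a))) (sumFin-const (s l) (g l)))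

-- The second factor is a Kronecker delta.
sumFin-≟ˡ : ∀ {k} (g : Fin k → ℕ) l → sumFin (λ l′ → g l′ * val (does (l Fin.≟ l′))) ≡ g l
sumFin-≟ˡ {suc k} g zero = begin
  g zero * 1 + sumFin (λ l′ → g (suc l′) * 0)  ≡⟨ cong₂ _+_ (*-identityʳ (g zero)) (sumFin-*ʳ 0 (g ∘ suc)) ⟩
  g zero + sumFin (g ∘ suc) * 0                ≡⟨ cong (g zero +_) (*-zeroʳ (sumFin (g ∘ suc))) ⟩
  g zero + 0                                   ≡⟨ +-identityʳ (g zero) ⟩
  g zero                                       ∎
  where open ≡-Reasoning
sumFin-≟ˡ {suc k} g (suc l) = cong₂ _+_ (*-zeroʳ (g zero)) (sumFin-≟ˡ (g ∘ suc) l)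

sumFin-≟ʳ : ∀ {k} (g : Fin k → ℕ) l → sumFin (λ l′ → g l′ * val (does (l′ Fin.≟ l))) ≡ g l
sumFin-≟ʳ g l = trans
  (sumFin-cong (λ l′ → cong (λ b → g l′ * val b) (does-sym l′))) (sumFin-≟ˡ g l)
  where
  does-sym : ∀ l′ → does (l′ Fin.≟ l) ≡ does (l Fin.≟ l′)
  does-sym l′ with l Fin.≟ l′
  ... | yes refl = dec-true (l Fin.≟ l) refl
  ... | no l≢l′  = dec-false (l′ Fin.≟ l) (l≢l′ ∘ sym)

-- A row interval and a column interval meet in ones exactly when their labels agree, so every
-- component is some J(x l, y l).
module BlockDiagonal {k} (x y : Fin k → ℕ) where

  rowLabel : Fin (sumFin x) → Fin k
  rowLabel = label x

  M : Matrix (sumFin x) (sumFin y)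
  M i j = does (rowLabel i Fin.≟ label y j)

  one⇒label≡ : ∀ {i j} → M i j ≡ true → rowLabel i ≡ label y j
  one⇒label≡ {i} {j} Mij with rowLabel i Fin.≟ label y j
  ... | yes eq = eq

  label≡⇒one : ∀ {i j} → rowLabel i ≡ label y j → M i j ≡ true
  label≡⇒one = dec-true (_ Fin.≟ _)

  rowSum≡ : ∀ i → rowSum M i ≡ y (rowLabel i)
  rowSum≡ i = trans (sumFin-label y (λ l → val (does (rowLabel i Fin.≟ l)))) (sumFin-≟ˡ y (rowLabel i))

  colSum≡ : ∀ j → colSum M j ≡ x (label y j)
  colSum≡ j = trans (sumFin-label x (λ l → val (does (l Fin.≟ label y j)))) (sumFin-≟ʳ x (label y j))

  ones≡ : ones M ≡ sumFin (λ l → x l * y l)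
  ones≡ = trans (sumFin-cong rowSum≡) (sumFin-label x y)

  -- Inside block `l`, κ equals x l + y l - 2. Outside the blocks it is a row sum plus a column sum,
  -- each at least 1.
  2TDS : (∀ l → 1 ≤ x l) → (∀ l → 1 ≤ y l) → (∀ l → 4 ≤ x l + y l) → IsKTDS 2 M
  2TDS 1≤x 1≤y 4≤x+y i j rewrite rowSum≡ i | colSum≡ j with rowLabel i Fin.≟ label y j
  ... | yes eq = ∸-monoˡ-≤ 2 (subst (λ l → 4 ≤ y (rowLabel i) + x l) eq
    (≤-trans (4≤x+y (rowLabel i)) (≤-reflexive (+-comm (x (rowLabel i)) _))))
  ... | no _ = +-mono-≤ (1≤y (rowLabel i)) (1≤x (label y j))

  -- The corner (i, j′) lies in the same block, so one walk along a row and one along a column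
  -- suffice.
  label≡⇒conn : ∀ {i j i′ j′} → M i j ≡ true → M i′ j′ ≡ true → rowLabel i ≡ rowLabel i′ →
    Conn M (i , j) (i′ , j′)
  label≡⇒conn {i} {j} {i′} {j′} Mij Mi′j′ eq =
    row-connected M Mij Mij′ ◅◅ col-connected M Mij′ Mi′j′
    where
    Mij′ : M i j′ ≡ true
    Mij′ = label≡⇒one (trans eq (one⇒label≡ Mi′j′))

  conn⇒label≡ : ∀ {p q} → Conn M p q → rowLabel (proj₁ p) ≡ rowLabel (proj₁ q)
  conn⇒label≡ ε = refl
  conn⇒label≡ ((_ , _ , inj₁ (refl , _)) ◅ c) = conn⇒label≡ c
  conn⇒label≡ ((Mij , Mi′j , inj₂ (refl , _)) ◅ c) =
    trans (trans (one⇒label≡ Mij) (sym (one⇒label≡ Mi′j))) (conn⇒label≡ c)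

  cell : ∀ l → Fin (x l) → Fin (y l) → Cell (sumFin x) (sumFin y)
  cell l a b = member x l a , member y l b

  cell-one : ∀ l a b → IsOne M (cell l a b)
  cell-one l a b = label≡⇒one (trans (label-member x l a) (sym (label-member y l b)))

  component : ∀ {i j} l → M i j ≡ true → rowLabel i ≡ l → CompIsJ M (i , j) (x l) (y l)
  component {i} {j} l Mij label≡l =
    member x l , member y l , member-injective x l , member-injective y l , within , covers
    where
    locate : ∀ {k} (s : Fin k → ℕ) {l i} → label s i ≡ l → ∃[ a ] member s l a ≡ i
    locate s {i = i} refl = member-label s i
    within : ∀ i′ j′ → M i′ j′ ≡ true × Conn M (i , j) (i′ , j′) →
      ∃[ a ] member x l a ≡ i′ × ∃[ b ] member y l b ≡ j′
    within i′ j′ (Mi′j′ , c) with trans (sym (conn⇒label≡ c)) label≡l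
    ... | eq with locate x eq | locate y (trans (sym (one⇒label≡ Mi′j′)) eq)
    ... | a , p | b , q = a , p , b , q
    covers : ∀ a b → M (member x l a) (member y l b) ≡ true × Conn M (i , j) (cell l a b)
    covers a b = cell-one l a b ,
      label≡⇒conn Mij (cell-one l a b) (trans label≡l (sym (label-member x l a)))

  cell-component : ∀ l a b → CompIsJ M (cell l a b) (x l) (y l)
  cell-component l a b = component l (cell-one l a b) (label-member x l a)

  ¬conn⇒label≢ : ∀ l a b {i j} → M i j ≡ true → ¬ Conn M (cell l a b) (i , j) → rowLabel i ≢ l
  ¬conn⇒label≢ l a b Mij ¬conn label≡l =
    ¬conn (label≡⇒conn (cell-one l a b) Mij (trans (label-member x l a) (sym label≡l)))

-- Shapes of blocks

Shape : Set
Shape = ℕ × ℕ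

data BasicShape : Shape → Set where
  J13 : BasicShape (1 , 3)
  J31 : BasicShape (3 , 1)

-- The parameters count the ones beyond four: components with 6 or 7 ones are never needed.
data Special : Set where
  none     : Special
  column   : Fin 2 → Special
  row      : Fin 2 → Special
  both     : Fin 2 → Fin 2 → Special

specials : Special → List Shape
specials none       = []
specials (column c) = (4 + toℕ c , 1) ∷ []
specials (row r)    = (1 , 4 + toℕ r) ∷ []
specials (both c r) = (4 + toℕ c , 1) ∷ (1 , 4 + toℕ r) ∷ []

basics : ℕ → ℕ → List Shape
basics (suc a) b       = (1 , 3) ∷ basics a b
basics zero    (suc b) = (3 , 1) ∷ basics zero b
basics zero    zero    = []

-- The special shapes come first, so that their blocks carry the labels 0 and 1.
blocks : Special → ℕ → ℕ → List Shape
blocks s a b = specials s ++ basics a b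

-- With `proj₁`, `proj₂` and `area` for `f`, this is the number of rows, columns and ones of the
-- block matrix.
total : (Shape → ℕ) → List Shape → ℕ
total f zs = sumFin (λ l → f (lookup zs l))

area : Shape → ℕ
area (p , q) = p * q

total-++ : ∀ f zs ws → total f (zs ++ ws) ≡ total f zs + total f ws
total-++ f []       ws = refl
total-++ f (z ∷ zs) ws = trans (cong (f z +_) (total-++ f zs ws)) (sym (+-assoc (f z) _ _))

total-basics : ∀ f a b → total f (basics a b) ≡ a * f (1 , 3) + b * f (3 , 1)
total-basics f (suc a) b =
  trans (cong (f (1 , 3) +_) (total-basics f a b)) (sym (+-assoc (f (1 , 3)) _ _))
total-basics f zero (suc b) = cong (f (3 , 1) +_) (total-basics f zero b)
total-basics f zero zero    = refl

total-blocks : ∀ f s a b →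
  total f (blocks s a b) ≡ total f (specials s) + (a * f (1 , 3) + b * f (3 , 1))
total-blocks f s a b = trans (total-++ f (specials s) (basics a b))
  (cong (total f (specials s) +_) (total-basics f a b))

basics-basic : ∀ a b → All BasicShape (basics a b)
basics-basic (suc a) b       = J13 ∷ basics-basic a b
basics-basic zero    (suc b) = J31 ∷ basics-basic zero b
basics-basic zero    zero    = []

Valid : Shape → Set
Valid (p , q) = 1 ≤ p × 1 ≤ q × 4 ≤ p + q

basic⇒valid : ∀ {z} → BasicShape z → Valid z
basic⇒valid J13 = s≤s z≤n , s≤s z≤n , ≤-refl
basic⇒valid J31 = s≤s z≤n , s≤s z≤n , ≤-refl

long-column : ∀ c → Valid (4 + c , 1)
long-column c = s≤s z≤n , s≤s z≤n , ≤-trans (m≤m+n 4 c) (m≤m+n (4 + c) 1)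

long-row : ∀ r → Valid (1 , 4 + r)
long-row r = s≤s z≤n , s≤s z≤n , ≤-trans (m≤m+n 4 r) (n≤1+n (4 + r))

specials-valid : ∀ s → All Valid (specials s)
specials-valid none       = []
specials-valid (column c) = long-column (toℕ c) ∷ []
specials-valid (row r)    = long-row (toℕ r) ∷ []
specials-valid (both c r) = long-column (toℕ c) ∷ long-row (toℕ r) ∷ []

blocks-valid : ∀ s a b → All Valid (blocks s a b)
blocks-valid s a b = ++⁺ (specials-valid s) (All.map basic⇒valid (basics-basic a b))

-- The expected number of ones

mod8-cong : ∀ u v w → u % 8 ≡ v % 8 → (u + w) % 8 ≡ (v + w) % 8
mod8-cong u v w eq = begin
  (u + w) % 8           ≡⟨ %-distribˡ-+ u w 8 ⟩
  (u % 8 + w % 8) % 8   ≡⟨ cong (λ t → (t + w % 8) % 8) eq ⟩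
  (v % 8 + w % 8) % 8   ≡⟨ %-distribˡ-+ v w 8 ⟨
  (v + w) % 8           ∎
  where open ≡-Reasoning

-- Adding `7 * w` completes `w` to a multiple of 8.
mod8-cancel : ∀ u v w → (u + w) % 8 ≡ (v + w) % 8 → u % 8 ≡ v % 8
mod8-cancel u v w eq = begin
  u % 8                ≡⟨ absorb u ⟨
  (u + w + 7 * w) % 8  ≡⟨ mod8-cong (u + w) (v + w) (7 * w) eq ⟩
  (v + w + 7 * w) % 8  ≡⟨ absorb v ⟩
  v % 8                ∎
  where
  open ≡-Reasoning
  regroup : ∀ t w → t + w + 7 * w ≡ t + w * 8
  regroup = solve-∀
  absorb : ∀ t → (t + w + 7 * w) % 8 ≡ t % 8
  absorb t = trans (cong (_% 8) (regroup t w)) ([m+kn]%n≡m%n t w 8)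

Exceptional : ℕ → ℕ → Set
Exceptional n m = m % 8 ≡ (3 * n + 4) % 8

expectedOnes-exceptional : ∀ n m → Exceptional n m → expectedOnes n m ≡ ceil3Quarter (n + m) + 1
expectedOnes-exceptional n m ex with m % 8 ≟ (3 * n + 4) % 8
... | yes _  = refl
... | no ¬ex = contradiction ex ¬ex

expectedOnes-ordinary : ∀ n m → ¬ Exceptional n m → expectedOnes n m ≡ ceil3Quarter (n + m)
expectedOnes-ordinary n m ¬ex with m % 8 ≟ (3 * n + 4) % 8
... | yes ex = contradiction ex ¬ex
... | no _   = refl

ceil3Quarter-+4* : ∀ s c → ceil3Quarter (s + c * 4) ≡ ceil3Quarter s + c * 3
ceil3Quarter-+4* s c = begin
  (3 * (s + c * 4) + 3) / 4              ≡⟨ cong (_/ 4) (regroup s c) ⟩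
  (3 * s + 3 + c * 3 * 4) / 4            ≡⟨ +-distrib-/-∣ʳ (3 * s + 3) (divides-refl (c * 3)) ⟩
  (3 * s + 3) / 4 + c * 3 * 4 / 4        ≡⟨ cong ((3 * s + 3) / 4 +_) (m*n/n≡m (c * 3) 4) ⟩
  (3 * s + 3) / 4 + c * 3                ∎
  where
  open ≡-Reasoning
  regroup : ∀ s c → 3 * (s + c * 4) + 3 ≡ 3 * s + 3 + c * 3 * 4
  regroup = solve-∀

module _ (n m a b : ℕ) where

  private
    n′ m′ : ℕ
    n′ = n + (a * 1 + b * 3)
    m′ = m + (a * 3 + b * 1)

    ceil′ : ceil3Quarter (n′ + m′) ≡ ceil3Quarter (n + m) + (a * 3 + b * 3)
    ceil′ = begin
      ceil3Quarter (n′ + m′)                  ≡⟨ cong ceil3Quarter (regroup n m a b) ⟩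
      ceil3Quarter (n + m + (a + b) * 4)      ≡⟨ ceil3Quarter-+4* (n + m) (a + b) ⟩
      ceil3Quarter (n + m) + (a + b) * 3      ≡⟨ cong (ceil3Quarter (n + m) +_) (*-distribʳ-+ 3 a b) ⟩
      ceil3Quarter (n + m) + (a * 3 + b * 3)  ∎
      where
      open ≡-Reasoning
      regroup : ∀ n m a b → n + (a * 1 + b * 3) + (m + (a * 3 + b * 1)) ≡ n + m + (a + b) * 4
      regroup = solve-∀

    rhs′ : (3 * n′ + 4) % 8 ≡ (3 * n + 4 + (a * 3 + b * 1)) % 8
    rhs′ = trans (cong (_% 8) (regroup n a b)) ([m+kn]%n≡m%n (3 * n + 4 + (a * 3 + b * 1)) b 8)
      where
      regroup : ∀ n a b → 3 * (n + (a * 1 + b * 3)) + 4 ≡ 3 * n + 4 + (a * 3 + b * 1) + b * 8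
      regroup = solve-∀

    exceptional⇒ : Exceptional n m → Exceptional n′ m′
    exceptional⇒ ex = trans (mod8-cong m (3 * n + 4) (a * 3 + b * 1) ex) (sym rhs′)

    exceptional⇐ : Exceptional n′ m′ → Exceptional n m
    exceptional⇐ ex = mod8-cancel m (3 * n + 4) (a * 3 + b * 1) (trans ex rhs′)

  -- Each basic block adds 4 to n + m, hence 3 to the ceiling. It changes m - 3n by 0 for J(1,3) and
  -- by -8 for J(3,1), so being exceptional is unaffected.
  expectedOnes-+basics : expectedOnes n′ m′ ≡ expectedOnes n m + (a * 3 + b * 3)
  expectedOnes-+basics with m % 8 ≟ (3 * n + 4) % 8
  ... | yes ex = begin
    expectedOnes n′ m′                            ≡⟨ expectedOnes-exceptional n′ m′ (exceptional⇒ ex) ⟩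
    ceil3Quarter (n′ + m′) + 1                    ≡⟨ cong (_+ 1) ceil′ ⟩
    ceil3Quarter (n + m) + (a * 3 + b * 3) + 1    ≡⟨ regroup (ceil3Quarter (n + m)) (a * 3 + b * 3) ⟩
    ceil3Quarter (n + m) + 1 + (a * 3 + b * 3)    ∎
    where
    open ≡-Reasoning
    regroup : ∀ c d → c + d + 1 ≡ c + 1 + d
    regroup = solve-∀
  ... | no ¬ex = trans (expectedOnes-ordinary n′ m′ (¬ex ∘ exceptional⇐)) ceil′

-- Closed computations. Only `both 1F 1F`, of size 6 × 6, is exceptional: it has ten ones, one more
-- than 3 · 12 / 4.
specials-area : ∀ s → expectedOnes (total proj₁ (specials s)) (total proj₂ (specials s)) ≡ total area (specials s)
specials-area none        = refl
specials-area (column 0F) = refl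
specials-area (column 1F) = refl
specials-area (row 0F)    = refl
specials-area (row 1F)    = refl
specials-area (both 0F 0F) = refl
specials-area (both 0F 1F) = refl
specials-area (both 1F 0F) = refl
specials-area (both 1F 1F) = refl

blocks-area : ∀ s a b →
  total area (blocks s a b) ≡ expectedOnes (total proj₁ (blocks s a b)) (total proj₂ (blocks s a b))
blocks-area s a b = begin
  total area (blocks s a b)                         ≡⟨ total-blocks area s a b ⟩
  total area (specials s) + (a * 3 + b * 3)         ≡⟨ cong (_+ (a * 3 + b * 3)) (specials-area s) ⟨
  expectedOnes p q + (a * 3 + b * 3)                ≡⟨ expectedOnes-+basics p q a b ⟨
  expectedOnes (p + (a * 1 + b * 3)) (q + (a * 3 + b * 1))
    ≡⟨ cong₂ expectedOnes (total-blocks proj₁ s a b) (total-blocks proj₂ s a b) ⟨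
  expectedOnes (total proj₁ (blocks s a b)) (total proj₂ (blocks s a b)) ∎
  where
  open ≡-Reasoning
  p = total proj₁ (specials s)
  q = total proj₂ (specials s)

-- The lower bound by the expected number of ones

module _ {n m} (M : Matrix n m) (tds : IsKTDS 2 M) (nzr : NoZeroRow M) (nzc : NoZeroCol M) where

  open LowerBound M tds nzr nzc

  private
    E = ones M

    ceil3Quarter≤E : ceil3Quarter (n + m) ≤ E
    ceil3Quarter≤E = begin
      (3 * (n + m) + 3) / 4    ≤⟨ /-monoˡ-≤ 4 (+-monoˡ-≤ 3 3[n+m]≤4E) ⟩
      (4 * E + 3) / 4          ≡⟨ cong (_/ 4) (regroup E) ⟩
      (3 + E * 4) / 4          ≡⟨ +-distrib-/-∣ʳ 3 {d = 4} (divides-refl E) ⟩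
      E * 4 / 4                ≡⟨ m*n/n≡m E 4 ⟩
      E                        ∎
      where
      open ≤-Reasoning
      regroup : ∀ e → 4 * e + 3 ≡ 3 + e * 4
      regroup = solve-∀

    module _ (ex : Exceptional n m) where

      A B : ℕ
      A = m / 8
      B = (3 * n + 4) / 8

      -- The congruence m ≡ 3n + 4 (mod 8) as an equation free of subtraction.
      balance : m + B * 8 ≡ 3 * n + 4 + A * 8
      balance = begin
        m + B * 8                           ≡⟨ cong (_+ B * 8) (m≡m%n+[m/n]*n m 8) ⟩
        m % 8 + A * 8 + B * 8               ≡⟨ cong (λ r → r + A * 8 + B * 8) ex ⟩
        (3 * n + 4) % 8 + A * 8 + B * 8     ≡⟨ regroup ((3 * n + 4) % 8) (A * 8) (B * 8) ⟩
        (3 * n + 4) % 8 + B * 8 + A * 8     ≡⟨ cong (_+ A * 8) (m≡m%n+[m/n]*n (3 * n + 4) 8) ⟨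
        3 * n + 4 + A * 8                   ∎
        where
        open ≡-Reasoning
        regroup : ∀ r a b → r + a + b ≡ r + b + a
        regroup = solve-∀

      -- Modulo 4, n + m is n + 3n + 4, a multiple of 4.
      4∣n+m : 4 ∣ n + m
      4∣n+m = ∣m+n∣m⇒∣n (divides (n + 1 + A * 2) (begin
        B * 2 * 4 + (n + m)            ≡⟨ regroup₁ n m B ⟩
        n + (m + B * 8)                ≡⟨ cong (n +_) balance ⟩
        n + (3 * n + 4 + A * 8)        ≡⟨ regroup₂ n A ⟩
        (n + 1 + A * 2) * 4            ∎)) (divides-refl (B * 2))
        where
        open ≡-Reasoning
        regroup₁ : ∀ n m b → b * 2 * 4 + (n + m) ≡ n + (m + b * 8)
        regroup₁ = solve-∀
        regroup₂ : ∀ n a → n + (3 * n + 4 + a * 8) ≡ (n + 1 + a * 2) * 4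
        regroup₂ = solve-∀

      -- Tightness would give m ≡ 3n (mod 8) besides m ≡ 3n + 4, so 8 would divide 4.
      4E≢3[n+m] : 4 * E ≢ 3 * (n + m)
      4E≢3[n+m] tight with tight⇒m≡3n[mod8] tight
      ... | h , m+8h≡3n = from-no (8 ∣? 4) (∣m+n∣m⇒∣n (divides B (+-cancelˡ-≡ m _ _ (begin
        m + ((h + A) * 8 + 4)          ≡⟨ regroup m h A ⟩
        m + 8 * h + 4 + A * 8          ≡⟨ cong (λ t → t + 4 + A * 8) m+8h≡3n ⟩
        3 * n + 4 + A * 8              ≡⟨ balance ⟨
        m + B * 8                      ∎))) (divides-refl (h + A)))
        where
        open ≡-Reasoning
        regroup : ∀ m h a → m + ((h + a) * 8 + 4) ≡ m + 8 * h + 4 + a * 8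
        regroup = solve-∀

      -- Since 4 divides n + m, the ceiling rounds nothing, and equality with E would be the tight
      -- case.
      ceil3Quarter<E : ceil3Quarter (n + m) < E
      ceil3Quarter<E with 4∣n+m
      ... | divides q n+m≡q*4 = ≤∧≢⇒< ceil3Quarter≤E λ ceil≡E → 4E≢3[n+m] (begin
        4 * E                             ≡⟨ cong (4 *_) ceil≡E ⟨
        4 * ceil3Quarter (n + m)          ≡⟨ cong (λ s → 4 * ceil3Quarter s) n+m≡q*4 ⟩
        4 * ceil3Quarter (0 + q * 4)      ≡⟨ cong (4 *_) (ceil3Quarter-+4* 0 q) ⟩
        4 * (q * 3)                       ≡⟨ regroup q ⟩
        3 * (q * 4)                       ≡⟨ cong (3 *_) n+m≡q*4 ⟨
        3 * (n + m)                       ∎)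
        where
        open ≡-Reasoning
        regroup : ∀ q → 4 * (q * 3) ≡ 3 * (q * 4)
        regroup = solve-∀

  expectedOnes≤ones : expectedOnes n m ≤ E
  expectedOnes≤ones with m % 8 ≟ (3 * n + 4) % 8
  ... | yes ex = ≤-trans (≤-reflexive (+-comm _ 1)) (ceil3Quarter<E ex)
  ... | no _   = ceil3Quarter≤E

-- Block matrices with prescribed components

module Blocks (zs : List Shape) where

  open BlockDiagonal (λ l → proj₁ (lookup zs l)) (λ l → proj₂ (lookup zs l)) public

  Basic-component : ∀ {i j} → M i j ≡ true → BasicShape (lookup zs (rowLabel i)) → Basic M (i , j)
  Basic-component {i} Mij basic with lookup zs (rowLabel i) | component (rowLabel i) Mij refl | basic
  ... | _ | isJ | J13 = inj₁ isJ
  ... | _ | isJ | J31 = inj₂ isJ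

blockMatrix : ∀ s a b → Matrix (total proj₁ (blocks s a b)) (total proj₂ (blocks s a b))
blockMatrix s a b = Blocks.M (blocks s a b)

blockMatrix-2TDS : ∀ s a b → IsKTDS 2 (blockMatrix s a b)
blockMatrix-2TDS s a b =
  Blocks.2TDS (blocks s a b) (proj₁ ∘ valid) (proj₁ ∘ proj₂ ∘ valid) (proj₂ ∘ proj₂ ∘ valid)
  where
  valid : ∀ l → Valid (lookup (blocks s a b) l)
  valid l = All.lookup (blocks-valid s a b) (∈-lookup l)

blockMatrix-ones : ∀ s a b →
  ones (blockMatrix s a b) ≡ expectedOnes (total proj₁ (blocks s a b)) (total proj₂ (blocks s a b))
blockMatrix-ones s a b = trans (Blocks.ones≡ (blocks s a b)) (blocks-area s a b)

basic-lookup : ∀ a b l → BasicShape (lookup (basics a b) l)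
basic-lookup a b l = All.lookup (basics-basic a b) (∈-lookup l)

basic-lookup₁ : ∀ z a b l → l ≢ zero → BasicShape (lookup (z ∷ basics a b) l)
basic-lookup₁ z a b zero    l≢0 = contradiction refl l≢0
basic-lookup₁ z a b (suc l) _   = basic-lookup a b l

basic-lookup₂ : ∀ z w a b l → l ≢ zero → l ≢ suc zero → BasicShape (lookup (z ∷ w ∷ basics a b) l)
basic-lookup₂ z w a b zero    l≢0 _   = contradiction refl l≢0
basic-lookup₂ z w a b (suc l) _   l≢1 = basic-lookup₁ w a b l (l≢1 ∘ cong suc)

4+toℕ≤5 : ∀ (c : Fin 2) → 4 + toℕ c ≤ 5
4+toℕ≤5 c = +-monoʳ-≤ 4 (Fin.toℕ≤pred[n] c)

4+toℕ≤7 : ∀ (c : Fin 2) → 4 + toℕ c ≤ 7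
4+toℕ≤7 c = ≤-trans (4+toℕ≤5 c) (m≤m+n 5 2)

-- A one not connected to a chosen cell of a special block has a label other than that block's, so
-- it lies in a basic block once all special ones are avoided.
blockMatrix-good : ∀ s a b → GoodComponents (blockMatrix s a b)
blockMatrix-good none a b = inj₁ λ _ one → Basic-component one (basic-lookup a b _)
  where open Blocks (blocks none a b)
blockMatrix-good (column c) a b = inj₂ (inj₁
  ( _ , m≤m+n 4 _ , 4+toℕ≤7 c , cell 0F 0F 0F , cell-one 0F 0F 0F , cell-component 0F 0F 0F
  , λ _ one apart → Basic-component one (basic-lookup₁ _ a b _ (¬conn⇒label≢ 0F 0F 0F one apart))))
  where open Blocks (blocks (column c) a b)
blockMatrix-good (row r) a b = inj₂ (inj₂ (inj₁
  ( _ , m≤m+n 4 _ , 4+toℕ≤7 r , cell 0F 0F 0F , cell-one 0F 0F 0F , cell-component 0F 0F 0F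
  , λ _ one apart → Basic-component one (basic-lookup₁ _ a b _ (¬conn⇒label≢ 0F 0F 0F one apart)))))
  where open Blocks (blocks (row r) a b)
blockMatrix-good (both c r) a b = inj₂ (inj₂ (inj₂
  ( _ , _ , m≤m+n 4 _ , 4+toℕ≤5 c , m≤m+n 4 _ , 4+toℕ≤5 r
  , cell 0F 0F 0F , cell 1F 0F 0F , cell-one 0F 0F 0F , cell-one 1F 0F 0F
  , cell-component 0F 0F 0F , cell-component 1F 0F 0F
  , λ _ one apart₀ apart₁ → Basic-component one
      (basic-lookup₂ _ _ a b _ (¬conn⇒label≢ 0F 0F 0F one apart₀) (¬conn⇒label≢ 1F 0F 0F one apart₁)))))
  where open Blocks (blocks (both c r) a b)

-- Decomposing the dimensions into blocks

-- The parameters of an n × m block matrix, with the dimensions in the form that `total-blocks`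
-- yields.
record Decomposition (n m : ℕ) : Set where
  constructor decomposition
  field
    special      : Special
    #13 #31      : ℕ
    rows≡        : total proj₁ (specials special) + (#13 * 1 + #31 * 3) ≡ n
    columns≡     : total proj₂ (specials special) + (#13 * 3 + #31 * 1) ≡ m

transpose : Special → Special
transpose none       = none
transpose (column c) = row c
transpose (row r)    = column r
transpose (both c r) = both r c

transpose-rows : ∀ s → total proj₁ (specials (transpose s)) ≡ total proj₂ (specials s)
transpose-rows none       = refl
transpose-rows (column c) = refl
transpose-rows (row r)    = refl
transpose-rows (both c r) = regroup (toℕ r)
  where
  regroup : ∀ r → 4 + r + 1 ≡ 1 + (4 + r + 0)
  regroup = solve-∀

transpose-columns : ∀ s → total proj₂ (specials (transpose s)) ≡ total proj₁ (specials s)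
transpose-columns none       = refl
transpose-columns (column c) = refl
transpose-columns (row r)    = refl
transpose-columns (both c r) = regroup (toℕ c)
  where
  regroup : ∀ c → 1 + (4 + c + 0) ≡ 4 + c + 1
  regroup = solve-∀

Decomposition-swap : ∀ {n m} → Decomposition n m → Decomposition m n
Decomposition-swap (decomposition s a b rows≡ columns≡) = decomposition (transpose s) b a
  (trans (cong₂ _+_ (transpose-rows s) (+-comm (b * 1) (a * 3))) columns≡)
  (trans (cong₂ _+_ (transpose-columns s) (+-comm (b * 3) (a * 1))) rows≡)

Decomposition-+J13 : ∀ {n m} t → Decomposition n m → Decomposition (t + n) (3 * t + m)
Decomposition-+J13 t (decomposition s a b refl refl) = decomposition s (t + a) b
  (rows (total proj₁ (specials s)) t a b) (columns (total proj₂ (specials s)) t a b)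
  where
  rows : ∀ p t a b → p + ((t + a) * 1 + b * 3) ≡ t + (p + (a * 1 + b * 3))
  rows = solve-∀
  columns : ∀ q t a b → q + ((t + a) * 3 + b * 1) ≡ 3 * t + (q + (a * 3 + b * 1))
  columns = solve-∀

Decomposition-+J31 : ∀ {n m} t → Decomposition n m → Decomposition (3 * t + n) (t + m)
Decomposition-+J31 t = Decomposition-swap ∘ Decomposition-+J13 t ∘ Decomposition-swap

Decomposition-4+ : ∀ {n m} → Decomposition n m → Decomposition (4 + n) (4 + m)
Decomposition-4+ = Decomposition-+J13 1 ∘ Decomposition-+J31 1

-- One J(1,3) and one J(3,1) together enlarge both dimensions by 4, so sizes 4 to 7 suffice as base
-- cases. `superdiagonal` works in the same way.
diagonal : ∀ n → Decomposition (4 + n) (4 + n)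
diagonal 0 = decomposition none 1 1 refl refl
diagonal 1 = decomposition (both 0F 0F) 0 0 refl refl
diagonal 2 = decomposition (both 1F 1F) 0 0 refl refl
diagonal 3 = decomposition (column 1F) 2 0 refl refl
diagonal (suc (suc (suc (suc n)))) = Decomposition-4+ (diagonal n)

superdiagonal : ∀ n → Decomposition (4 + n) (5 + n)
superdiagonal 0 = decomposition (row 0F) 0 1 refl refl
superdiagonal 1 = decomposition (both 0F 1F) 0 0 refl refl
superdiagonal 2 = decomposition (column 0F) 2 0 refl refl
superdiagonal 3 = decomposition (both 1F 0F) 1 0 refl refl
superdiagonal (suc (suc (suc (suc n)))) = Decomposition-4+ (superdiagonal n)

-- The sizes 2 × 3 and 3 × 5 satisfy 3m ≤ 5n but have no decomposition. They are ruled out later,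
-- since no minimum matrix of these sizes is free of zero rows and columns.
Exceptions : ℕ → ℕ → Set
Exceptions n m = Excluded n m ⊎ (n ≡ 2 × m ≡ 3) ⊎ (n ≡ 3 × m ≡ 5)

-- The dimensions are (N + t, N + 3t) or (N + t, N + 1 + 3t): t blocks J(1,3) reduce them to
-- (near-)square ones, and the bound 3m ≤ 5n leaves few cases with N < 4.
decompose-even : ∀ N t → 1 ≤ t + N → t * 4 ≤ N * 2 → ¬ Exceptions (t + N) (3 * t + N) →
  Decomposition (t + N) (3 * t + N)
decompose-even 0 0 () _ _
decompose-even 0 (suc t) _ () _
decompose-even 1 0 _ _ ¬ex = contradiction (inj₁ (inj₁ (refl , refl))) ¬ex
decompose-even 1 (suc t) _ (s≤s (s≤s ())) _
decompose-even 2 0 _ _ ¬ex = contradiction (inj₁ (inj₂ (inj₂ (inj₂ (inj₁ (refl , refl)))))) ¬ex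
decompose-even 2 1 _ _ ¬ex = contradiction (inj₂ (inj₂ (refl , refl))) ¬ex
decompose-even 2 (suc (suc t)) _ (s≤s (s≤s (s≤s (s≤s ())))) _
decompose-even 3 0 _ _ ¬ex = contradiction (inj₁ (inj₂ (inj₂ (inj₂ (inj₂ (inj₁ (refl , refl))))))) ¬ex
-- The size is 4 × 6, split into J(1,5) and J(3,1).
decompose-even 3 1 _ _ _ = decomposition (row 1F) 0 1 refl refl
decompose-even 3 (suc (suc t)) _ (s≤s (s≤s (s≤s (s≤s (s≤s (s≤s ())))))) _
decompose-even (suc (suc (suc (suc N)))) t _ _ _ = Decomposition-+J13 t (diagonal N)

decompose-odd : ∀ N t → 3 + t * 4 ≤ N * 2 → ¬ Exceptions (t + N) (3 * t + (1 + N)) →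
  Decomposition (t + N) (3 * t + (1 + N))
decompose-odd 0 t () _
decompose-odd 1 t (s≤s (s≤s ())) _
decompose-odd 2 0 _ ¬ex = contradiction (inj₂ (inj₁ (refl , refl))) ¬ex
decompose-odd 2 (suc t) (s≤s (s≤s (s≤s (s≤s ())))) _
decompose-odd 3 0 _ ¬ex = contradiction (inj₁ (inj₂ (inj₂ (inj₂ (inj₂ (inj₂ (inj₁ (refl , refl)))))))) ¬ex
decompose-odd 3 (suc t) (s≤s (s≤s (s≤s (s≤s (s≤s (s≤s ())))))) _
decompose-odd (suc (suc (suc (suc N)))) t _ _ = Decomposition-+J13 t (superdiagonal N)

even⊎odd : ∀ d → ∃[ t ] (d ≡ 2 * t ⊎ d ≡ 2 * t + 1)
even⊎odd zero = 0 , inj₁ refl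
even⊎odd (suc d) with even⊎odd d
... | t , inj₁ refl = t , inj₂ (+-comm 1 (2 * t))
... | t , inj₂ refl = suc t , inj₁ (regroup t)
  where
  regroup : ∀ t → suc (2 * t + 1) ≡ 2 * suc t
  regroup = solve-∀

-- Each J(1,3) accounts for 2 of the difference d = m - n. With t = ⌊d/2⌋ such blocks removed, N = n
-- - t rows and N or N + 1 columns remain, according to the parity of d.
decompose : ∀ n m → 1 ≤ n → n ≤ m → 3 * m ≤ 5 * n → ¬ Exceptions n m → Decomposition n m
decompose n m 1≤n n≤m 3m≤5n ¬ex with m≤n⇒∃[o]m+o≡n n≤m
... | d , refl with even⊎odd d
... | t , d≡ with m≤n⇒∃[o]m+o≡n t≤n
  where
  open ≤-Reasoning
  2t≤d : ∀ {d} → (d ≡ 2 * t ⊎ d ≡ 2 * t + 1) → 2 * t ≤ d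
  2t≤d (inj₁ refl) = ≤-refl
  2t≤d (inj₂ refl) = m≤m+n _ 1
  regroup₁ : ∀ n d → 3 * d + 3 * n ≡ 3 * (n + d)
  regroup₁ = solve-∀
  regroup₂ : ∀ n → 5 * n ≡ 2 * n + 3 * n
  regroup₂ = solve-∀
  -- The bound 3m ≤ 5n says 3d ≤ 2n, whence 2t ≤ d ≤ 3d ≤ 2n.
  t≤n : t ≤ n
  t≤n = *-cancelˡ-≤ 2 (≤-trans (2t≤d d≡) (≤-trans (m≤m+n d _) (+-cancelʳ-≤ (3 * n) _ _ (begin
    3 * d + 3 * n   ≡⟨ regroup₁ n d ⟩
    3 * (n + d)     ≤⟨ 3m≤5n ⟩
    5 * n           ≡⟨ regroup₂ n ⟩
    2 * n + 3 * n   ∎))))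
... | N , refl with d≡
... | inj₁ refl = subst (Decomposition (t + N)) (even t N)
  -- Cancelling 5t + 3N from 3m ≤ 5n leaves 4t ≤ 2N; the odd case leaves 3 + 4t ≤ 2N.
  (decompose-even N t 1≤n (+-cancelʳ-≤ (5 * t + 3 * N) _ _ (subst₂ _≤_ (lhs t N) (rhs t N) 3m≤5n))
    (¬ex ∘ subst (Exceptions (t + N)) (even t N)))
  where
  even : ∀ t N → 3 * t + N ≡ t + N + 2 * t
  even = solve-∀
  lhs : ∀ t N → 3 * (t + N + 2 * t) ≡ t * 4 + (5 * t + 3 * N)
  lhs = solve-∀
  rhs : ∀ t N → 5 * (t + N) ≡ N * 2 + (5 * t + 3 * N)
  rhs = solve-∀
... | inj₂ refl = subst (Decomposition (t + N)) (odd t N)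
  (decompose-odd N t (+-cancelʳ-≤ (5 * t + 3 * N) _ _ (subst₂ _≤_ (lhs t N) (rhs t N) 3m≤5n))
    (¬ex ∘ subst (Exceptions (t + N)) (odd t N)))
  where
  odd : ∀ t N → 3 * t + (1 + N) ≡ t + N + (2 * t + 1)
  odd = solve-∀
  lhs : ∀ t N → 3 * (t + N + (2 * t + 1)) ≡ 3 + t * 4 + (5 * t + 3 * N)
  lhs = solve-∀
  rhs : ∀ t N → 5 * (t + N) ≡ N * 2 + (5 * t + 3 * N)
  rhs = solve-∀

-- Upper bounds on the minimum

firstColumns : ∀ {n m} → ℕ → Matrix n m
firstColumns k i j = toℕ j <ᵇ k

sumFin-<ᵇ : ∀ {m} k → k ≤ m → sumFin {m} (λ j → val (toℕ j <ᵇ k)) ≡ k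
sumFin-<ᵇ {m} zero _ = trans (sumFin-const m 0) (*-zeroʳ m)
sumFin-<ᵇ (suc k) (s≤s k≤m) = cong suc (sumFin-<ᵇ k k≤m)

-- In the full columns κ is k + n - 2; in the empty ones it is k.
firstColumns-2TDS : ∀ {n m k} → k ≤ m → 2 ≤ k → 4 ≤ k + n → IsKTDS 2 (firstColumns {n} {m} k)
firstColumns-2TDS {n} {m} {k} k≤m 2≤k 4≤k+n i j
  rewrite sumFin-<ᵇ {m} k k≤m | sumFin-const n (val (toℕ j <ᵇ k)) with toℕ j <ᵇ k
... | true rewrite *-identityʳ n = ∸-monoˡ-≤ 2 4≤k+n
... | false = ≤-trans 2≤k (m≤m+n k _)

-- Applied with k = 2 for n ≥ 2, and with k = 3 for n = 1, where two full columns would not be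
-- enough.
minimum≤n*k : ∀ {n m} (M : Matrix n m) k → k ≤ m → 2 ≤ k → 4 ≤ k + n → IsMinKTDS 2 M → ones M ≤ n * k
minimum≤n*k {n} {m} M k k≤m 2≤k 4≤k+n (_ , least) = ≤-trans
  (least (firstColumns k) (firstColumns-2TDS k≤m 2≤k 4≤k+n))
  (≤-reflexive (trans (sumFin-cong {f = rowSum (firstColumns {n} {m} k)} {g = λ _ → k} (λ _ → sumFin-<ᵇ k k≤m)) (sumFin-const n k)))

colSum≤n : ∀ {n m} (M : Matrix n m) j → colSum M j ≤ n
colSum≤n {n} M j = ≤-trans (sumFin-mono-≤ (λ i → val≤1 (M i j)))
  (≤-reflexive (trans (sumFin-const n 1) (*-identityʳ n)))
  where
  val≤1 : ∀ b → val b ≤ 1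
  val≤1 false = z≤n
  val≤1 true  = ≤-refl

-- Column sums are at most 2, so every row sum is at least 2; with four ones both row sums
-- equal 2, and then every column sum is at least 2.
4<ones-2×3 : (M : Matrix 2 3) → IsKTDS 2 M → NoZeroRow M → NoZeroCol M → 4 < ones M
4<ones-2×3 M tds nzr nzc = ≰⇒> λ E≤4 →
  <⇒≱ (m≤n+m 5 1) (≤-trans (sumFin-mono-≤ (2≤colSum E≤4)) (≤-trans (≤-reflexive (ones-ᵀ M)) E≤4))
  where
  2≤rowSum : ∀ i → 2 ≤ rowSum M i
  2≤rowSum i with nzr i
  ... | j , Mij = +-cancelʳ-≤ 2 _ _
    (≤-trans (one⇒4≤r+c M tds Mij) (+-monoʳ-≤ (rowSum M i) (colSum≤n M j)))
  rowSum≤2 : ones M ≤ 4 → ∀ i → rowSum M i ≤ 2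
  rowSum≤2 E≤4 i = ≤-reflexive (sym (sumFin-≤-≡ 2≤rowSum E≤4 i))
  2≤colSum : ones M ≤ 4 → ∀ j → 2 ≤ colSum M j
  2≤colSum E≤4 j with nzc j
  ... | i , Mij = +-cancelˡ-≤ 2 _ _
    (≤-trans (one⇒4≤r+c M tds Mij) (+-monoˡ-≤ (colSum M j) (rowSum≤2 E≤4 i)))

-- Combining decompositions with the lower bound

Good2TDS : ∀ n m → Set
Good2TDS n m = ∃[ M ] (IsMinKTDS {n} {m} 2 M × GoodComponents M × ones M ≡ expectedOnes n m)

FullMin2TDS : ∀ n m → Set
FullMin2TDS n m = ∃[ M ] (IsMinKTDS {n} {m} 2 M × NoZeroRow M × NoZeroCol M)

-- The discharging bound is applied to the given matrix `M₀` alone. Minimality of `M₀` then carries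
-- it to every competitor `N`, including those with zero rows or columns.
assemble : ∀ {n m} → Decomposition n m → FullMin2TDS n m → Good2TDS n m
assemble (decomposition s a b rows≡ columns≡) full
  with trans (total-blocks proj₁ s a b) rows≡ | trans (total-blocks proj₂ s a b) columns≡
assemble (decomposition s a b _ _) (M₀ , (tds , least) , nzr , nzc) | refl | refl =
  blockMatrix s a b
  , (blockMatrix-2TDS s a b , λ N Ntds → ≤-trans (≤-reflexive (blockMatrix-ones s a b))
      (≤-trans (expectedOnes≤ones M₀ tds nzr nzc) (least N Ntds)))
  , blockMatrix-good s a b
  , blockMatrix-ones s a b

decompose-full : ∀ {n m} → 1 ≤ n → n ≤ m → ¬ Excluded n m → FullMin2TDS n m → Decomposition n m
decompose-full {1} {1} _ _ ¬ex _ = contradiction (inj₁ (refl , refl)) ¬ex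
decompose-full {1} {2} _ _ ¬ex _ = contradiction (inj₂ (inj₁ (refl , refl))) ¬ex
decompose-full {1} {3} _ _ _ _ = decomposition none 1 0 refl refl
decompose-full {1} {m@(suc (suc (suc (suc m′))))} _ _ _ (M₀ , min , nzr , nzc) =
  contradiction (begin
    -- A single row with m ≥ 4 is impossible: discharging needs 4E ≥ 15, while three ones already
    -- suffice.
    15                     ≤⟨ *-monoʳ-≤ 3 (m≤m+n 5 m′) ⟩
    3 * (1 + m)            ≤⟨ LowerBound.3[n+m]≤4E M₀ (proj₁ min) nzr nzc ⟩
    4 * ones M₀            ≤⟨ *-monoʳ-≤ 4 (minimum≤n*k M₀ 3 (m≤m+n 3 _) (n≤1+n 2) ≤-refl min) ⟩
    12                     ∎) (<⇒≱ (m≤m+n 13 2))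
  where open ≤-Reasoning
decompose-full {n@(suc (suc n′))} {m} 1≤n n≤m ¬ex (M₀ , min@(tds , _) , nzr , nzc) =
  decompose n m 1≤n n≤m 3m≤5n λ where
    (inj₁ ex)                        → ¬ex ex
    (inj₂ (inj₁ (refl , refl)))      → <⇒≱ (4<ones-2×3 M₀ tds nzr nzc) E≤2n
    -- Here 3(n + m) = 24 and E ≤ 6, so the bound is tight, although 5 and 9 differ modulo 8.
    (inj₂ (inj₂ (refl , refl)))      → ¬tight-3×5
      (tight⇒m≡3n[mod8] (≤-antisym (*-monoʳ-≤ 4 E≤2n) 3[n+m]≤4E))
  where
  open LowerBound M₀ tds nzr nzc
  E≤2n : ones M₀ ≤ n * 2
  E≤2n = minimum≤n*k M₀ 2 (≤-trans (m≤m+n 2 n′) n≤m) ≤-refl (m≤m+n 4 n′) min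
  ¬tight-3×5 : ¬ (∃[ h ] 5 + 8 * h ≡ 9)
  ¬tight-3×5 (suc h , eq) = contradiction (trans (sym eq) (regroup h)) λ ()
    where
    regroup : ∀ h → 5 + 8 * suc h ≡ 13 + 8 * h
    regroup = solve-∀
  3m≤5n : 3 * m ≤ 5 * n
  3m≤5n = +-cancelˡ-≤ (3 * n) _ _ (begin
    3 * n + 3 * m          ≡⟨ *-distribˡ-+ 3 n m ⟨
    3 * (n + m)            ≤⟨ 3[n+m]≤4E ⟩
    4 * ones M₀            ≤⟨ *-monoʳ-≤ 4 E≤2n ⟩
    4 * (n * 2)            ≡⟨ regroup n ⟩
    3 * n + 5 * n          ∎)
    where
    open ≤-Reasoning
    regroup : ∀ n → 4 * (n * 2) ≡ 3 * n + 5 * n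
    regroup = solve-∀

Excluded-swap : ∀ {n m} → Excluded n m → Excluded m n
Excluded-swap (inj₁ (p , q))                                           = inj₁ (q , p)
Excluded-swap (inj₂ (inj₁ (p , q)))                                    = inj₂ (inj₂ (inj₁ (q , p)))
Excluded-swap (inj₂ (inj₂ (inj₁ (p , q))))                             = inj₂ (inj₁ (q , p))
Excluded-swap (inj₂ (inj₂ (inj₂ (inj₁ (p , q)))))                      = inj₂ (inj₂ (inj₂ (inj₁ (q , p))))
Excluded-swap (inj₂ (inj₂ (inj₂ (inj₂ (inj₁ (p , q))))))               = inj₂ (inj₂ (inj₂ (inj₂ (inj₁ (q , p)))))
Excluded-swap (inj₂ (inj₂ (inj₂ (inj₂ (inj₂ (inj₁ (p , q)))))))        = inj₂ (inj₂ (inj₂ (inj₂ (inj₂ (inj₂ (q , p))))))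
Excluded-swap (inj₂ (inj₂ (inj₂ (inj₂ (inj₂ (inj₂ (p , q)))))))        = inj₂ (inj₂ (inj₂ (inj₂ (inj₂ (inj₁ (q , p))))))

theorem8 : (n m : ℕ) → n ≥ 1 → m ≥ 1 → ¬ Excluded n m →
    (∃[ M₀ ] (IsMinKTDS {n} {m} 2 M₀ × NoZeroRow M₀ × NoZeroCol M₀)) →
    ∃[ M ] (IsMinKTDS {n} {m} 2 M × GoodComponents M × ones M ≡ expectedOnes n m)
theorem8 n m 1≤n 1≤m ¬ex full@(M₀ , min , nzr , nzc) with ≤-total n m
... | inj₁ n≤m = assemble (decompose-full 1≤n n≤m ¬ex full) full
... | inj₂ m≤n = assemble (Decomposition-swap
  (decompose-full 1≤m m≤n (¬ex ∘ Excluded-swap) (M₀ ᵀ , IsMinKTDS-ᵀ M₀ min , nzc , nzr))) full
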